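{- Let $a,b\ge 1$, let $\rho$ be the canonical sequential form of a non-crossing partition of length $m$ for some $m\ge 1$, and let $\tau=1^a(\rho+1)1^b$. If $n\ge m+a+b-1$, then the total number of occurrences of the subword $\tau$ within all the members of $NC_n$, i.e. $\sum_{\pi\in NC_n}\mu_\tau(\pi)$, is $\binom{2r}{r+1}$, where $r=n-m-a-b+1$.
   Context: A set partition of $[n]=\{1,\dots,n\}$ with blocks $B_1,\dots,B_k$ ordered so that $\min B_1<\cdots<\min B_k$ is represented by its canonical sequential form $\pi=\pi_1\cdots\pi_n$, where $i\in B_{\pi_i}$ for each $i$; $n$ is its length. It is non-crossing if $\pi$ contains no (not necessarily consecutive) subsequence of the form $a\,b\,a\,b$ with $a<b$. $NC_n$ denotes the set of non-crossing partitions of $[n]$, identified with their canonical sequential forms. A subword pattern is a finite sequence $\tau=\tau_1\cdots\tau_k$ of positive integers whose set of distinct letters is $[\ell]$ for some $\ell$. An occurrence of $\tau$ in a sequence $\sigma_1\cdots\sigma_n$ is an index $i\in[n-k+1]$ such that the string of consecutive letters $\sigma_i\cdots\sigma_{i+k-1}$ is order-isomorphic to $\tau$ (same relative order, including equalities). $\mu_\tau(\pi)$ denotes the number of occurrences of $\tau$ in $\pi$. $\rho+1$ is the sequence obtained by adding $1$ to each entry of $\rho$, $1^a$ is the word of $a$ ones, and juxtaposition is concatenation. -}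

module Defs where

open import Data.Fin as Fin using (Fin; zero; suc; toℕ; fromℕ<)
import Data.Fin.Properties as Fin
open import Data.Fin.Subset as Subset using (Subset)
open import Data.List
  using (List; []; _∷_; length; map; lookup; tabulate; filter; take; drop; upTo; cartesianProductWith)
open import Data.List.Properties using (length-tabulate; tabulate-cong; tabulate-lookup; ∷-injective)
open import Data.List.Membership.Propositional using (_∈_; lose)
import Data.List.Membership.Propositional.Properties as ∈
open import Data.List.Relation.Unary.All using (All; []; _∷_)
import Data.List.Relation.Unary.All.Properties as All
open import Data.List.Relation.Unary.Any as Any using (here; there)
open import Data.List.Relation.Unary.Unique.Propositional using (Unique; []; _∷_)
import Data.List.Relation.Unary.Unique.Propositional.Properties as Unique
open import Data.Nat
import Data.Nat.Properties as ℕ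
open import Data.List.Relation.Binary.Sublist.DecPropositional ℕ._≟_
  using (_⊆_; _⊆?_) renaming (lookup to ⊆-lookup)
open import Data.Product using (Σ; ∃; ∃₂; ∃!; _×_; _,_; proj₁; proj₂)
open import Data.Sum using (_⊎_; inj₁; inj₂)
import Data.Vec as Vec
open import Data.Vec.Properties using (lookup⇒[]=; []=⇒lookup; lookup∘tabulate)
open import Data.Bool using (T)
open import Data.Unit using (tt)
open import Function using (_⇔_; mk⇔; Equivalence; _∘_)
open import Relation.Binary using (tri<; tri≈; tri>)
open import Relation.Binary.PropositionalEquality
open import Relation.Nullary using (Dec; yes; no; does; ¬_; contradiction; map′; ¬?; _×-dec_)
open import Relation.Nullary.Decidable using (dec-true)
open import Relation.Unary using (Decidable)

-- Set partitions, with [n] rendered as Fin n and blocks numbered from 0.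
-- The field `min` also makes every block nonempty.
record SetPartition (n : ℕ) : Set where
  field
    k       : ℕ
    block   : Fin k → Subset n
    cover   : ∀ i → ∃! _≡_ λ j → i Subset.∈ block j
    min     : Fin k → Fin n
    min∈    : ∀ j → min j Subset.∈ block j
    min≤    : ∀ j {i} → i Subset.∈ block j → min j Fin.≤ i
    ordered : ∀ {j j′} → j Fin.< j′ → min j Fin.< min j′

  blockOf : Fin n → Fin k
  blockOf i = proj₁ (cover i)

-- Letters are positive: the block with index j contributes the letter j + 1.
canonicalForm : ∀ {n} → SetPartition n → List ℕ
canonicalForm P = tabulate λ i → suc (toℕ (SetPartition.blockOf P i))

IsCanonicalForm : ℕ → List ℕ → Set
IsCanonicalForm n π = Σ (SetPartition n) λ P → canonicalForm P ≡ π

-- _⊆_ is the (not necessarily consecutive) subsequence relation.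
NonCrossing : List ℕ → Set
NonCrossing π = ¬ ∃₂ λ a b → a < b × (a ∷ b ∷ a ∷ b ∷ []) ⊆ π

IsNC : ℕ → List ℕ → Set
IsNC n π = IsCanonicalForm n π × NonCrossing π

OrderIsomorphic : List ℕ → List ℕ → Set
OrderIsomorphic u v = Σ (length u ≡ length v) λ eq → ∀ p q →
  (lookup u p < lookup u q ⇔ lookup v (Fin.cast eq p) < lookup v (Fin.cast eq q)) ×
  (lookup u p ≡ lookup u q ⇔ lookup v (Fin.cast eq p) ≡ lookup v (Fin.cast eq q))

-- i counts from 0, so that i + 1 is the index in [n - k + 1] of the occurrence.
OccursAt : List ℕ → List ℕ → ℕ → Set
OccursAt τ σ i = OrderIsomorphic (take (length τ) (drop i σ)) τ

infix 3 _⇔-dec_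
_⇔-dec_ : ∀ {A B : Set} → Dec A → Dec B → Dec (A ⇔ B)
yes a ⇔-dec yes b = yes (mk⇔ (λ _ → b) (λ _ → a))
yes a ⇔-dec no ¬b = no λ e → ¬b (Equivalence.to e a)
no ¬a ⇔-dec yes b = no λ e → ¬a (Equivalence.from e b)
no ¬a ⇔-dec no ¬b = yes (mk⇔ (λ a → contradiction a ¬a) (λ b → contradiction b ¬b))

orderIsomorphic? : ∀ u v → Dec (OrderIsomorphic u v)
orderIsomorphic? u v with length u ≟ length v
... | no ≢ = no (≢ ∘ proj₁)
... | yes eq = map′ (eq ,_)
  (λ (eq′ , f) → subst (λ e → ∀ p q →
      (lookup u p < lookup u q ⇔ lookup v (Fin.cast e p) < lookup v (Fin.cast e q)) ×
      (lookup u p ≡ lookup u q ⇔ lookup v (Fin.cast e p) ≡ lookup v (Fin.cast e q)))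
    (ℕ.≡-irrelevant eq′ eq) f)
  (Fin.all? λ p → Fin.all? λ q →
    (lookup u p <? lookup u q ⇔-dec lookup v (Fin.cast eq p) <? lookup v (Fin.cast eq q)) ×-dec
    (lookup u p ≟ lookup u q ⇔-dec lookup v (Fin.cast eq p) ≟ lookup v (Fin.cast eq q)))

occursAt? : ∀ τ σ → Decidable (OccursAt τ σ)
occursAt? τ σ i = orderIsomorphic? (take (length τ) (drop i σ)) τ

μ : List ℕ → List ℕ → ℕ
μ τ σ = length (filter (occursAt? τ σ) (upTo (suc (length σ) ∸ length τ)))

nonCrossing? : Decidable NonCrossing
nonCrossing? π = ¬? (map′ to from
  (Any.any? (λ a → Any.any? (λ b → (a <? b) ×-dec ((a ∷ b ∷ a ∷ b ∷ []) ⊆? π)) π) π))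
  where
  to : Any.Any (λ a → Any.Any (λ b → a < b × (a ∷ b ∷ a ∷ b ∷ []) ⊆ π) π) π →
       ∃₂ λ a b → a < b × (a ∷ b ∷ a ∷ b ∷ []) ⊆ π
  to any with a , any′ ← Any.satisfied any with b , w ← Any.satisfied any′ = a , b , w
  from : (∃₂ λ a b → a < b × (a ∷ b ∷ a ∷ b ∷ []) ⊆ π) →
         Any.Any (λ a → Any.Any (λ b → a < b × (a ∷ b ∷ a ∷ b ∷ []) ⊆ π) π) π
  from (a , b , a<b , s) =
    lose (⊆-lookup s (here refl)) (lose (⊆-lookup s (there (here refl))) (a<b , s))

-- Restricted growth: each letter is positive and preceded by all smaller
-- positive letters.  This is used only to decide IsCanonicalForm.
Growth : ∀ {n} → (Fin n → ℕ) → Set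
Growth f = ∀ q → 1 ≤ f q × (∀ (c : Fin (pred (f q))) → ∃ λ p → p Fin.< q × f p ≡ suc (toℕ c))

growth? : ∀ {n} (f : Fin n → ℕ) → Dec (Growth f)
growth? f = Fin.all? λ q → (1 ≤? f q) ×-dec
  Fin.all? λ c → Fin.any? λ p → (p Fin.<? q) ×-dec (f p ≟ suc (toℕ c))

partition⇒growth : ∀ {n} (P : SetPartition n) (f : Fin n → ℕ) →
  (∀ i → f i ≡ suc (toℕ (SetPartition.blockOf P i))) → Growth f
partition⇒growth P f f≡ q rewrite f≡ q = s≤s z≤n , λ c →
  let c′<k : toℕ c < k
      c′<k = ℕ.<-trans (Fin.toℕ<n c) (Fin.toℕ<n (blockOf q))
      j = fromℕ< c′<k
      j<  : j Fin.< blockOf q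
      j<  = subst (_< toℕ (blockOf q)) (sym (Fin.toℕ-fromℕ< c′<k)) (Fin.toℕ<n c)
  in min j , ℕ.<-≤-trans (ordered j<) (min≤ (blockOf q) (proj₁ (proj₂ (cover q)))) ,
     trans (f≡ (min j)) (cong suc (trans (cong toℕ (proj₂ (proj₂ (cover (min j))) (min∈ j)))
                                         (Fin.toℕ-fromℕ< c′<k)))
  where open SetPartition P

maximum : ∀ {n} (f : Fin n → ℕ) →
  ∃ λ k → (∀ i → f i ≤ k) × (k ≡ 0 ⊎ ∃ λ q → f q ≡ k)
maximum {zero} f = 0 , (λ ()) , inj₁ refl
maximum {suc n} f with k , ub , att ← maximum (f ∘ suc) with ℕ.≤-total (f zero) k
... | inj₂ k≤ = f zero , (λ { zero → ℕ.≤-refl ; (suc i) → ℕ.≤-trans (ub i) k≤ }) , inj₂ (zero , refl)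
... | inj₁ ≤k = k , (λ { zero → ≤k ; (suc i) → ub i }) , lift att
  where
  lift : (k ≡ 0 ⊎ ∃ λ q → f (suc q) ≡ k) → (k ≡ 0 ⊎ ∃ λ q → f q ≡ k)
  lift (inj₁ e) = inj₁ e
  lift (inj₂ (q , e)) = inj₂ (suc q , e)

least : ∀ {n} {P : Fin n → Set} → Decidable P → ∃ P →
  ∃ λ i → P i × (∀ {i′} → P i′ → i Fin.≤ i′)
least {suc n} {P} P? (i , pi) with P? zero
... | yes p0 = zero , p0 , λ _ → z≤n
least {suc n} P? (zero , p) | no ¬p0 = contradiction p ¬p0
least {suc n} {P} P? (suc i , p) | no ¬p0 with m , pm , m≤ ← least (P? ∘ suc) (i , p) =
  suc m , pm , λ { {zero} p0 → contradiction p0 ¬p0 ; {suc _} p′ → s≤s (m≤ p′) }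

growth⇒partition : ∀ {n} (f : Fin n → ℕ) → Growth f →
  Σ (SetPartition n) λ P → ∀ i → suc (toℕ (SetPartition.blockOf P i)) ≡ f i
growth⇒partition {n} f g = record
  { k = K ; block = block ; cover = cover
  ; min = λ j → proj₁ (first j)
  ; min∈ = λ j → ∈block (proj₁ (proj₂ (first j)))
  ; min≤ = λ j i∈ → proj₂ (proj₂ (first j)) (block∈ i∈)
  ; ordered = ordered } , λ i → label≡ i
  where
  K = proj₁ (maximum f)
  ub = proj₁ (proj₂ (maximum f))

  block : Fin K → Subset n
  block j = Vec.tabulate λ i → does (f i ≟ suc (toℕ j))

  ∈block : ∀ {i j} → f i ≡ suc (toℕ j) → i Subset.∈ block j
  ∈block {i} {j} e = lookup⇒[]= i (block j)
    (trans (lookup∘tabulate _ i) (dec-true (f i ≟ suc (toℕ j)) e))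

  block∈ : ∀ {i j} → i Subset.∈ block j → f i ≡ suc (toℕ j)
  block∈ {i} {j} m = ℕ.≡ᵇ⇒≡ (f i) (suc (toℕ j))
    (subst T (trans (sym ([]=⇒lookup m)) (lookup∘tabulate _ i)) tt)

  earlier : ∀ q (c : ℕ) → suc c < f q → ∃ λ p → p Fin.< q × f p ≡ suc c
  earlier q c c< with f q | g q
  ... | suc x | _ , h with p , p<q , e ← h (fromℕ< (ℕ.≤-pred c<)) =
    p , p<q , trans e (cong suc (Fin.toℕ-fromℕ< _))

  attained : ∀ (j : Fin K) → ∃ λ i → f i ≡ suc (toℕ j)
  attained j with proj₂ (proj₂ (maximum f))
  ... | inj₁ K≡0 = contradiction (subst (toℕ j <_) K≡0 (Fin.toℕ<n j)) λ ()
  ... | inj₂ (q , fq≡K) with ℕ.m≤n⇒m<n∨m≡n (subst (suc (toℕ j) ≤_) (sym fq≡K) (Fin.toℕ<n j))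
  ... | inj₂ e = q , sym e
  ... | inj₁ lt with p , _ , e ← earlier q (toℕ j) lt = p , e

  first : ∀ j → ∃ λ i → f i ≡ suc (toℕ j) × (∀ {i′} → f i′ ≡ suc (toℕ j) → i Fin.≤ i′)
  first j = least (λ i → f i ≟ suc (toℕ j)) (attained j)

  ordered : ∀ {j j′} → j Fin.< j′ → proj₁ (first j) Fin.< proj₁ (first j′)
  ordered {j} {j′} j<j′
    with q , fq , _ ← first j′
    with p , p<q , fp ← earlier q (toℕ j) (subst (suc (toℕ j) <_) (sym fq) (s≤s j<j′))
    = ℕ.≤-<-trans (proj₂ (proj₂ (first j)) fp) p<q

  pred< : ∀ i → pred (f i) < K
  pred< i with f i | ub i | proj₁ (g i)
  ... | suc x | le | _ = le

  suc-pred : ∀ i → suc (pred (f i)) ≡ f i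
  suc-pred i with f i | proj₁ (g i)
  ... | suc x | _ = refl

  label≡ : ∀ i → suc (toℕ (fromℕ< (pred< i))) ≡ f i
  label≡ i = trans (cong suc (Fin.toℕ-fromℕ< (pred< i))) (suc-pred i)

  cover : ∀ i → ∃! _≡_ λ j → i Subset.∈ block j
  cover i = fromℕ< (pred< i) , ∈block (sym (label≡ i)) ,
    λ m → Fin.toℕ-injective (ℕ.suc-injective (trans (label≡ i) (block∈ m)))

tabulate≡⇒lookup : ∀ (π : List ℕ) (f : Fin (length π) → ℕ) → tabulate f ≡ π → ∀ i → lookup π i ≡ f i
tabulate≡⇒lookup (x ∷ π) f e zero = sym (proj₁ (∷-injective e))
tabulate≡⇒lookup (x ∷ π) f e (suc i) = tabulate≡⇒lookup π (f ∘ suc) (proj₂ (∷-injective e)) i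

length-canonicalForm : ∀ {n π} → IsCanonicalForm n π → length π ≡ n
length-canonicalForm (P , refl) = length-tabulate _

canonicalForm⇔growth : ∀ π → IsCanonicalForm (length π) π ⇔ Growth (lookup π)
canonicalForm⇔growth π = mk⇔
  (λ (P , e) → partition⇒growth P (lookup π) (tabulate≡⇒lookup π _ e))
  (λ g → let P , h = growth⇒partition (lookup π) g
         in P , trans (tabulate-cong h) (tabulate-lookup π))

isCanonicalForm? : ∀ n → Decidable (IsCanonicalForm n)
isCanonicalForm? n π with length π ≟ n
... | no ≢ = no (≢ ∘ length-canonicalForm)
... | yes refl = map′ (Equivalence.from (canonicalForm⇔growth π))
                      (Equivalence.to (canonicalForm⇔growth π)) (growth? (lookup π))

isNC? : ∀ n → Decidable (IsNC n)
isNC? n π = isCanonicalForm? n π ×-dec nonCrossing? π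

-- All words of length n over the alphabet {1, …, ℓ}.
words : ℕ → ℕ → List (List ℕ)
words ℓ zero    = [] ∷ []
words ℓ (suc n) = cartesianProductWith _∷_ (map suc (upTo ℓ)) (words ℓ n)

-- The canonical form of a partition of [n] has letters in {1, …, n}, so
-- nothing is lost by restricting to these words; see ∈-NC.
NC : ℕ → List (List ℕ)
NC n = filter (isNC? n) (words n n)

∈-words : ∀ {ℓ} n {w} → length w ≡ n → All (λ x → 1 ≤ x × x ≤ ℓ) w → w ∈ words ℓ n
∈-words zero {[]} _ _ = here refl
∈-words (suc n) {suc x ∷ w} e ((_ , x≤) ∷ ws) =
  ∈.∈-cartesianProductWith⁺ _∷_ (∈.∈-map⁺ suc (∈.∈-upTo⁺ x≤)) (∈-words n (ℕ.suc-injective e) ws)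
∈-words (suc n) {zero ∷ w} e ((() , _) ∷ ws)

words-unique : ∀ ℓ n → Unique (words ℓ n)
words-unique ℓ zero    = [] ∷ []
words-unique ℓ (suc n) = Unique.cartesianProductWith⁺ _∷_ ∷-injective
  (Unique.map⁺ ℕ.suc-injective (Unique.upTo⁺ ℓ)) (words-unique ℓ n)

blocks≤ : ∀ {n} (P : SetPartition n) → SetPartition.k P ≤ n
blocks≤ P = Fin.injective⇒≤ {f = min} inj
  where
  open SetPartition P
  inj : ∀ {x y} → min x ≡ min y → x ≡ y
  inj {x} {y} e with Fin.<-cmp x y
  ... | tri< x<y _ _ = contradiction (ordered x<y) (Fin.<-irrefl e)
  ... | tri≈ _ x≡y _ = x≡y
  ... | tri> _ _ y<x = contradiction (ordered y<x) (Fin.<-irrefl (sym e))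

∈-NC : ∀ {n π} → π ∈ NC n ⇔ IsNC n π
∈-NC {n} {π} = mk⇔
  (λ m → proj₂ (∈.∈-filter⁻ (isNC? n) {xs = words n n} m))
  (λ nc → ∈.∈-filter⁺ (isNC? n)
    (∈-words n (length-canonicalForm (proj₁ nc)) (letters (proj₁ nc))) nc)
  where
  letters : ∀ {π} → IsCanonicalForm n π → All (λ x → 1 ≤ x × x ≤ n) π
  letters (P , refl) = All.tabulate⁺ λ i →
    s≤s z≤n , ℕ.≤-trans (Fin.toℕ<n (SetPartition.blockOf P i)) (blocks≤ P)

NC-unique : ∀ n → Unique (NC n)
NC-unique n = Unique.filter⁺ (isNC? n) (words-unique n n)

{-# OPTIONS --safe #-}

-- Read a non-crossing form from left to right, keeping the largest letter M used so far and the
-- stack of letters that may still occur again.  The next letter is either M + 1, which is pushed,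
-- or a letter of the stack, above which everything is popped.  The number of words of length n
-- readable from a state depends only on the depth of the stack; it is a ballot number, which the
-- reflection principle evaluates.
--
-- After a letter x, an occurrence of τ starting at this x can be completed in exactly one way: the
-- letters of ρ must all be new, since old letters above x have been popped, so they are those of
-- ρ + M; afterwards x is again on top of the same stack.  Hence the occurrences starting at a given
-- letter are counted by the words that are shorter by |τ| - 1 = n - r letters, and by induction
-- on r the total is r times the number of words of length r, i.e. r times a Catalan number.
module Submission where

open import Defs
open import Data.Nat
open import Data.Nat.Properties
open import Data.Nat.Combinatorics using (_C_; nC1≡n; nCk≡nC[n∸k]; nCk+nC[k+1]≡[n+1]C[k+1])
open import Data.Nat.ListAction using (sum)
open import Data.Nat.ListAction.Properties using (sum-++; sum-↭)
open import Data.Nat.Tactic.RingSolver using (solve-∀)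
open import Algebra.Properties.CommutativeSemigroup +-commutativeSemigroup using (interchange)
import Data.Fin as Fin
open import Data.Fin.Properties using (toℕ<n; toℕ-fromℕ<)
open import Data.List
  using (List; []; _∷_; _++_; length; map; replicate; lookup; zip; take; drop; filter; upTo)
open import Data.List.Properties hiding (sum-++)
open import Data.List.Membership.Propositional using (_∈_; _∉_)
open import Data.List.Membership.Propositional.Properties
open import Data.List.Membership.Propositional.Properties.WithK using (unique∧set⇒bag)
open import Data.List.Relation.Unary.All as All using (All; []; _∷_)
open import Data.List.Relation.Unary.AllPairs as AllPairs using (AllPairs; []; _∷_)
open import Data.List.Relation.Unary.Any using (here; there)
open import Data.List.Relation.Unary.Unique.Propositional using (Unique)
import Data.List.Relation.Unary.Unique.Propositional.Properties as Unique
open import Data.List.Relation.Binary.BagAndSetEquality using (∼bag⇒↭)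
open import Data.List.Relation.Binary.Permutation.Propositional using (_↭_)
open import Data.List.Relation.Binary.Permutation.Propositional.Properties as ↭ using (↭-length)
open import Data.List.Relation.Binary.Pointwise as Pointwise using (Pointwise; []; _∷_; Pointwise-length)
open import Data.List.Relation.Binary.Sublist.Propositional
  using (_⊆_; []; _∷_; _∷ʳ_; from∈) renaming (lookup to ⊆-lookup)
open import Data.List.Relation.Binary.Sublist.Propositional.Properties using (∷ˡ⁻)
open import Data.Bool using (true; false)
open import Data.Product using (∃; ∃₂; ∃-syntax; _×_; _,_; proj₁; proj₂)
open import Data.Sum using (inj₁; inj₂)
open import Function using (_∘_; _⇔_; mk⇔; Equivalence; flip)
open import Relation.Binary.PropositionalEquality
open import Relation.Nullary using (¬_; yes; no; contradiction; does)
open import Relation.Unary using (Decidable)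

private variable
  c d x y n M M₁ M₂ : ℕ
  S S₁ S₂ u v w u₂ v₂ : List ℕ

-- Stacks and walks: reading a word letter by letter.

-- Stacks are listed from the top.
infix 4 _↘_
data _↘_ : List ℕ → List ℕ → Set where
  keep : S ↘ S
  pop  : S ↘ S₁ → y ∷ S ↘ S₁

-- Walk M S w M₁ S₁: reading w leads from maximum M and stack S to maximum M₁ and stack S₁.
data Walk (M : ℕ) (S : List ℕ) : List ℕ → ℕ → List ℕ → Set where
  []  : Walk M S [] M S
  new : Walk (suc M) (suc M ∷ S) w M₁ S₁ → Walk M S (suc M ∷ w) M₁ S₁
  old : S ↘ y ∷ S₂ → Walk M (y ∷ S₂) w M₁ S₁ → Walk M S (y ∷ w) M₁ S₁

IsStack : ℕ → List ℕ → Set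
IsStack M S = All (λ y → 1 ≤ y × y ≤ M) S × AllPairs _>_ S

↘⇒∈ : S ↘ y ∷ S₁ → y ∈ S
↘⇒∈ keep    = here refl
↘⇒∈ (pop s) = there (↘⇒∈ s)

∈⇒↘ : y ∈ S → ∃[ S₁ ] S ↘ y ∷ S₁
∈⇒↘ (here refl) = _ , keep
∈⇒↘ (there y∈)  = _ , pop (proj₂ (∈⇒↘ y∈))

All-↘ : ∀ {P : ℕ → Set} → All P S → S ↘ S₁ → All P S₁
All-↘ ps       keep    = ps
All-↘ (_ ∷ ps) (pop s) = All-↘ ps s

AllPairs-↘ : ∀ {R : ℕ → ℕ → Set} → AllPairs R S → S ↘ S₁ → AllPairs R S₁
AllPairs-↘ ps       keep    = ps
AllPairs-↘ (_ ∷ ps) (pop s) = AllPairs-↘ ps s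

↘-unique : AllPairs _>_ S → S ↘ y ∷ S₁ → S ↘ y ∷ S₂ → S₁ ≡ S₂
↘-unique _        keep    keep    = refl
↘-unique (y> ∷ _) keep    (pop t) = contradiction (All.lookup y> (↘⇒∈ t)) (<-irrefl refl)
↘-unique (y> ∷ _) (pop s) keep    = contradiction (All.lookup y> (↘⇒∈ s)) (<-irrefl refl)
↘-unique (_ ∷ ps) (pop s) (pop t) = ↘-unique ps s t

pushStack : IsStack M S → IsStack (suc M) (suc M ∷ S)
pushStack (bs , ps) =
  (s≤s z≤n , ≤-refl) ∷ All.map (λ (p , q) → p , m≤n⇒m≤1+n q) bs ,
  All.map (s≤s ∘ proj₂) bs ∷ ps

popStack : IsStack M S → S ↘ S₁ → IsStack M S₁
popStack (bs , ps) s = All-↘ bs s , AllPairs-↘ ps s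

walkStack : IsStack M S → Walk M S w M₁ S₁ → IsStack M₁ S₁
walkStack st []        = st
walkStack st (new r)   = walkStack (pushStack st) r
walkStack st (old s r) = walkStack (popStack st s) r

1+M∉stack : IsStack M S → suc M ∉ S
1+M∉stack (bs , _) m = 1+n≰n (proj₂ (All.lookup bs m))

walk-++⁺ : Walk M S u M₁ S₁ → Walk M₁ S₁ v M₂ S₂ → Walk M S (u ++ v) M₂ S₂
walk-++⁺ []        q = q
walk-++⁺ (new p)   q = new (walk-++⁺ p q)
walk-++⁺ (old s p) q = old s (walk-++⁺ p q)

walk-++⁻ : ∀ u → Walk M S (u ++ v) M₂ S₂ → ∃₂ λ M₁ S₁ → Walk M S u M₁ S₁ × Walk M₁ S₁ v M₂ S₂
walk-++⁻ []      p         = _ , _ , [] , p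
walk-++⁻ (_ ∷ u) (new p)   with _ , _ , q , r ← walk-++⁻ u p = _ , _ , new q , r
walk-++⁻ (_ ∷ u) (old s p) with _ , _ , q , r ← walk-++⁻ u p = _ , _ , old s q , r

-- The word dictates every move: a fresh letter is never on the stack, and a strictly decreasing
-- stack holds each letter only once, so there is one place to pop to. Hence any walk along `u ++ v`
-- passes through the state that the given walk along `u` reaches.
walk-determined : IsStack M S → Walk M S u M₁ S₁ → Walk M S (u ++ v) M₂ S₂ → Walk M₁ S₁ v M₂ S₂
walk-determined st []        q         = q
walk-determined st (new p)   (new q)   = walk-determined (pushStack st) p q
walk-determined st (new p)   (old s q) = contradiction (↘⇒∈ s) (1+M∉stack st)
walk-determined st (old s p) (new q)   = contradiction (↘⇒∈ s) (1+M∉stack st)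
walk-determined st (old s p) (old t q) with refl ← ↘-unique (proj₂ st) s t =
  walk-determined (popStack st s) p q

walk-replicate : ∀ k → Walk M (y ∷ S) (replicate k y) M (y ∷ S)
walk-replicate zero    = []
walk-replicate (suc k) = old keep (walk-replicate k)

++-↘ : ∀ S → S ++ S₁ ↘ S₁
++-↘ []      = keep
++-↘ (_ ∷ S) = pop (++-↘ S)

translate-↘ : ∀ j → S ↘ S₁ → map (j +_) S ++ S₂ ↘ map (j +_) S₁ ++ S₂
translate-↘ j keep    = keep
translate-↘ j (pop s) = pop (translate-↘ j s)

-- A walk only touches its own part of the stack, so an arbitrary `S₂` can lie underneath. This lets
-- a shifted copy of `ρ` be read above an existing stack.
translate : ∀ j → Walk M S w M₁ S₁ →
            Walk (j + M) (map (j +_) S ++ S₂) (map (j +_) w) (j + M₁) (map (j +_) S₁ ++ S₂)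
translate j [] = []
translate {M = M} {S₂ = S₂} j (new p) with translate {S₂ = S₂} j p
... | q rewrite +-suc j M = new q
translate j (old s p) = old (translate-↘ j s) (translate j p)

untranslate-↘ : ∀ j S → map (j +_) S ↘ y ∷ S₁ → ∃₂ λ c S₂ → y ≡ j + c × S₁ ≡ map (j +_) S₂ × S ↘ c ∷ S₂
untranslate-↘ j (c ∷ S) keep    = c , S , refl , refl , keep
untranslate-↘ j (_ ∷ S) (pop s) with c , S₂ , e , e′ , t ← untranslate-↘ j S s = c , S₂ , e , e′ , pop t

-- Each letter read is either fresh, hence beyond `j + M`, or taken from the shifted stack; in both
-- cases `j` can be subtracted from it.
untranslate : ∀ j S → Walk (j + M) (map (j +_) S) w M₁ S₁ →
              ∃[ u ] w ≡ map (j +_) u × ∃₂ (Walk M S u)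
untranslate j S [] = [] , refl , _ , _ , []
untranslate {M = M} {M₁ = M₁} {S₁ = S₁} j S (new {w = w} p)
  with u , refl , _ , _ , q ← untranslate {M = suc M} j (suc M ∷ S)
         (subst (λ x → Walk x (x ∷ map (j +_) S) w M₁ S₁) (sym (+-suc j M)) p)
  = suc M ∷ u , cong (_∷ map (j +_) u) (sym (+-suc j M)) , _ , _ , new q
untranslate j S (old s p)
  with c , S₂ , refl , refl , t ← untranslate-↘ j S s
  with u , refl , _ , _ , q ← untranslate j (c ∷ S₂) p
  = c ∷ u , refl , _ , _ , old t q

restrict-↘ : ∀ T {x} → All (_≤ x) S → T ++ S ↘ y ∷ S₁ → x < y → ∃[ T₁ ] S₁ ≡ T₁ ++ S × T ↘ y ∷ T₁
restrict-↘ (_ ∷ T) ≤x keep    x<y = T , refl , keep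
restrict-↘ (_ ∷ T) ≤x (pop s) x<y with T₁ , e , t ← restrict-↘ T ≤x s x<y = T₁ , e , pop t
restrict-↘ []      ≤x s       x<y = contradiction (All.lookup ≤x (↘⇒∈ s)) (<⇒≱ x<y)

-- Letters above `x` never pop down into `S`, so `S` can be removed from the bottom of the stack.
restrict : ∀ T {x} → All (_≤ x) S → Walk M (T ++ S) w M₁ S₁ → All (x <_) w → ∃₂ (Walk M T w)
restrict T ≤x []        _         = _ , _ , []
restrict T ≤x (new p)   (_ ∷ >x)  with _ , _ , q ← restrict (_ ∷ T) ≤x p >x = _ , _ , new q
restrict T ≤x (old s p) (x<y ∷ >x)
  with T₁ , refl , t ← restrict-↘ T ≤x s x<y
  with _ , _ , q ← restrict (_ ∷ T₁) ≤x p >x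
  = _ , _ , old t q

-- Enumeration of the readable words.

-- Note the shift: readsOld n M S lists the readable words of length n + 1 whose first letter is on the stack.
reads : ℕ → ℕ → List ℕ → List (List ℕ)
readsOld : ℕ → ℕ → List ℕ → List (List ℕ)

reads zero    M S = [] ∷ []
reads (suc n) M S = map (suc M ∷_) (reads n (suc M) (suc M ∷ S)) ++ readsOld n M S

readsOld n M []      = []
readsOld n M (y ∷ S) = map (y ∷_) (reads n M (y ∷ S)) ++ readsOld n M S

∈-readsOld⁺ : S ↘ y ∷ S₁ → w ∈ reads n M (y ∷ S₁) → y ∷ w ∈ readsOld n M S
∈-readsOld⁺ keep m = ∈-++⁺ˡ (∈-map⁺ _ m)
∈-readsOld⁺ {n = n} {M = M} (pop {S = S} {y = z} s) m = ∈-++⁺ʳ (map (z ∷_) (reads n M (z ∷ S))) (∈-readsOld⁺ s m)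

∈-readsOld⁻ : ∀ S → w ∈ readsOld n M S →
              ∃[ y ] ∃₂ λ S₁ u → w ≡ y ∷ u × S ↘ y ∷ S₁ × u ∈ reads n M (y ∷ S₁)
∈-readsOld⁻ {n = n} {M = M} (y ∷ S) m with ∈-++⁻ (map (y ∷_) (reads n M (y ∷ S))) m
... | inj₁ m′ with u , u∈ , refl ← ∈-map⁻ (y ∷_) m′ = y , S , u , refl , keep , u∈
... | inj₂ m′ with z , S₁ , u , e , s , u∈ ← ∈-readsOld⁻ S m′ = z , S₁ , u , e , pop s , u∈

∈-reads⁺ : Walk M S w M₁ S₁ → w ∈ reads (length w) M S
∈-reads⁺ []        = here refl
∈-reads⁺ (new p)   = ∈-++⁺ˡ (∈-map⁺ _ (∈-reads⁺ p))
∈-reads⁺ {M = M} {S = S} (old {w = w} s p) =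
  ∈-++⁺ʳ (map (suc M ∷_) (reads (length w) (suc M) (suc M ∷ S))) (∈-readsOld⁺ s (∈-reads⁺ p))

∈-reads⁻ : ∀ n → w ∈ reads n M S → length w ≡ n × ∃₂ (Walk M S w)
∈-reads⁻ zero (here refl) = refl , _ , _ , []
∈-reads⁻ {M = M} {S = S} (suc n) m with ∈-++⁻ (map (suc M ∷_) (reads n (suc M) (suc M ∷ S))) m
... | inj₁ m′ with u , u∈ , refl ← ∈-map⁻ (suc M ∷_) m′
              with refl , _ , _ , p ← ∈-reads⁻ n u∈ = refl , _ , _ , new p
... | inj₂ m′ with _ , _ , u , refl , s , u∈ ← ∈-readsOld⁻ S m′
              with refl , _ , _ , p ← ∈-reads⁻ n u∈ = refl , _ , _ , old s p

reads-unique : ∀ n → IsStack M S → Unique (reads n M S)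
readsOld-unique : ∀ n → IsStack M S → Unique (readsOld n M S)

reads-unique zero    st = [] ∷ []
reads-unique {M} {S} (suc n) st = Unique.++⁺
  (Unique.map⁺ ∷-injectiveʳ (reads-unique n (pushStack st))) (readsOld-unique n st)
  λ (m , m′) → disjoint (∈-map⁻ (suc M ∷_) m) (∈-readsOld⁻ S m′)
  where
  disjoint : ∃[ u ] u ∈ reads n (suc M) (suc M ∷ S) × w ≡ suc M ∷ u →
             ¬ (∃[ y ] ∃₂ λ S₁ u → w ≡ y ∷ u × S ↘ y ∷ S₁ × u ∈ reads n M (y ∷ S₁))
  disjoint (_ , _ , refl) (_ , _ , _ , refl , s , _) = 1+M∉stack st (↘⇒∈ s)

readsOld-unique {M} {[]}    n st = []
readsOld-unique {M} {y ∷ S} n st@(_ , y> ∷ _) = Unique.++⁺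
  (Unique.map⁺ ∷-injectiveʳ (reads-unique n st)) (readsOld-unique n (popStack st (pop keep)))
  λ (m , m′) → disjoint (∈-map⁻ (y ∷_) m) (∈-readsOld⁻ S m′)
  where
  disjoint : ∃[ u ] u ∈ reads n M (y ∷ S) × w ≡ y ∷ u →
             ¬ (∃[ z ] ∃₂ λ S₁ u → w ≡ z ∷ u × S ↘ z ∷ S₁ × u ∈ reads n M (z ∷ S₁))
  disjoint (_ , _ , refl) (_ , _ , _ , refl , s , _) = <-irrefl refl (All.lookup y> (↘⇒∈ s))

-- Ballot numbers as counts of readable words.

-- From depth `d` one letter leads once to each of the depths 1, ..., `d + 1`. The recurrence is the
-- telescoped form of that sum; at depth 0 the values are the Catalan numbers.
ballot : ℕ → ℕ → ℕ
ballot zero    d       = 1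
ballot (suc n) zero    = ballot n 1
ballot (suc n) (suc d) = ballot n (2 + d) + ballot (suc n) d

sum-map-++ : ∀ {A : Set} (F : A → ℕ) xs ys → sum (map F (xs ++ ys)) ≡ sum (map F xs) + sum (map F ys)
sum-map-++ F xs ys = trans (cong sum (map-++ F xs ys)) (sum-++ (map F xs) (map F ys))

-- Sums a statistic over all first letters, given that its sum for one first letter depends only on
-- the resulting depth. It serves twice: with the constant 1 for counting words, and with `μ τ`,
-- where the word length and the ballot index `r` differ.
module _ (F : List ℕ → ℕ) (k n r : ℕ)
  (sum-branch : ∀ {M y S} → IsStack M (y ∷ S) →
    sum (map F (map (y ∷_) (reads n M (y ∷ S)))) ≡ k * ballot r (suc (length S))) where

  -- The summand in front stands for the branch of the new letter. With it, each stack letter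
  -- removed corresponds to one unfolding of the recurrence of `ballot`.
  sum-readsOld : IsStack M S →
    k * ballot r (suc (length S)) + sum (map F (readsOld n M S)) ≡ k * ballot (suc r) (length S)
  sum-readsOld {S = []} st = +-identityʳ _
  sum-readsOld {M} {S = y ∷ S} st = begin
    B₂ + sum (map F (map (y ∷_) (reads n M (y ∷ S)) ++ readsOld n M S))
      ≡⟨ cong (B₂ +_) (sum-map-++ F (map (y ∷_) (reads n M (y ∷ S))) _) ⟩
    B₂ + (sum (map F (map (y ∷_) (reads n M (y ∷ S)))) + sum (map F (readsOld n M S)))
      ≡⟨ cong (λ x → B₂ + (x + sum (map F (readsOld n M S)))) (sum-branch st) ⟩
    B₂ + (k * ballot r (suc (length S)) + sum (map F (readsOld n M S)))
      ≡⟨ cong (B₂ +_) (sum-readsOld (popStack st (pop keep))) ⟩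
    B₂ + k * ballot (suc r) (length S)
      ≡⟨ *-distribˡ-+ k (ballot r (2 + length S)) _ ⟨
    k * ballot (suc r) (suc (length S)) ∎
    where
    open ≡-Reasoning
    B₂ = k * ballot r (2 + length S)

  sum-reads : IsStack M S → sum (map F (reads (suc n) M S)) ≡ k * ballot (suc r) (length S)
  sum-reads {M} {S} st = begin
    sum (map F (map (suc M ∷_) (reads n (suc M) (suc M ∷ S)) ++ readsOld n M S))
      ≡⟨ sum-map-++ F (map (suc M ∷_) (reads n (suc M) (suc M ∷ S))) _ ⟩
    sum (map F (map (suc M ∷_) (reads n (suc M) (suc M ∷ S)))) + sum (map F (readsOld n M S))
      ≡⟨ cong (_+ sum (map F (readsOld n M S))) (sum-branch (pushStack st)) ⟩
    k * ballot r (suc (length S)) + sum (map F (readsOld n M S))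
      ≡⟨ sum-readsOld st ⟩
    k * ballot (suc r) (length S) ∎
    where open ≡-Reasoning

length-reads : ∀ n → IsStack M S → length (reads n M S) ≡ ballot n (length S)
length-reads zero    st = refl
length-reads {M} {S} (suc n) st = begin
  length (reads (suc n) M S)              ≡⟨ sum-const (reads (suc n) M S) ⟨
  sum (map (λ _ → 1) (reads (suc n) M S)) ≡⟨ sum-reads _ 1 n n branch st ⟩
  1 * ballot (suc n) (length S)           ≡⟨ *-identityˡ _ ⟩
  ballot (suc n) (length S)               ∎
  where
  open ≡-Reasoning
  sum-const : ∀ (ws : List (List ℕ)) → sum (map (λ _ → 1) ws) ≡ length ws
  sum-const []       = refl
  sum-const (_ ∷ ws) = cong suc (sum-const ws)
  branch : ∀ {M y S} → IsStack M (y ∷ S) →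
    sum (map (λ _ → 1) (map (y ∷_) (reads n M (y ∷ S)))) ≡ 1 * ballot n (suc (length S))
  branch {M} {y} {S} st = begin
    sum (map (λ _ → 1) (map (y ∷_) (reads n M (y ∷ S)))) ≡⟨ sum-const (map (y ∷_) (reads n M (y ∷ S))) ⟩
    length (map (y ∷_) (reads n M (y ∷ S)))              ≡⟨ length-map _ (reads n M (y ∷ S)) ⟩
    length (reads n M (y ∷ S))                           ≡⟨ length-reads n st ⟩
    ballot n (suc (length S))                            ≡⟨ *-identityˡ _ ⟨
    1 * ballot n (suc (length S))                        ∎

-- Restricted growth and canonical forms.

-- Restricted growth read from left to right: the analogue of `Walk` in which all letters up to `M`
-- stay available.
data Grows (M : ℕ) : List ℕ → Set where
  []  : Grows M []
  old : 1 ≤ c × c ≤ M → Grows M w → Grows M (c ∷ w)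
  new : Grows (suc M) w → Grows M (suc M ∷ w)

walk⇒grows : IsStack M S → Walk M S w M₁ S₁ → Grows M w
walk⇒grows st []        = []
walk⇒grows st (new p)   = new (walk⇒grows (pushStack st) p)
walk⇒grows st (old s p) = old (All.lookup (proj₁ st) (↘⇒∈ s)) (walk⇒grows (popStack st s) p)

grows⇒positive : Grows M w → All (1 ≤_) w
grows⇒positive []            = []
grows⇒positive (old (p , _) g) = p ∷ grows⇒positive g
grows⇒positive (new g)       = s≤s z≤n ∷ grows⇒positive g

-- The maximum rises by one at a time, so every value between `M` and `y` is introduced on the way.
-- For `M = 0` the letters therefore form an initial segment of the positive integers.
grows⇒downClosed : Grows M w → y ∈ w → M < c → c ≤ y → c ∈ w
grows⇒downClosed (old (_ , y≤M) g) (here refl) M<c c≤y = contradiction (≤-trans c≤y y≤M) (<⇒≱ M<c)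
grows⇒downClosed (old _ g) (there m) M<c c≤y = there (grows⇒downClosed g m M<c c≤y)
grows⇒downClosed (new g) (here refl) M<c c≤y = here (≤-antisym c≤y M<c)
grows⇒downClosed (new g) (there m) M<c c≤y with m≤n⇒m<n∨m≡n M<c
... | inj₁ 1+M<c = there (grows⇒downClosed g m 1+M<c c≤y)
... | inj₂ refl  = here refl

-- `Growth` for a suffix, the letters 1, ..., `M` being taken as already seen; this is the form that
-- an induction along the word requires.
GrowthAfter : ℕ → List ℕ → Set
GrowthAfter M w = ∀ q → 1 ≤ lookup w q ×
  (∀ c → M < c → c < lookup w q → ∃ λ p → p Fin.< q × lookup w p ≡ c)

grows⇒growthAfter : Grows M w → GrowthAfter M w
grows⇒growthAfter (old (1≤y , y≤M) g) Fin.zero = 1≤y , λ c M<c c<y → contradiction (<-≤-trans c<y y≤M) (<⇒≯ M<c)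
grows⇒growthAfter (old _ g) (Fin.suc q) with pos , h ← grows⇒growthAfter g q =
  pos , λ c M<c c< → let p , p<q , e = h c M<c c< in Fin.suc p , s≤s p<q , e
grows⇒growthAfter (new g) Fin.zero = s≤s z≤n , λ c M<c c<y → contradiction c<y (≤⇒≯ M<c)
grows⇒growthAfter {M} (new g) (Fin.suc q) with pos , h ← grows⇒growthAfter g q = pos , earlier
  where
  earlier : ∀ c → M < c → c < _ → ∃ _
  earlier c M<c c< with m≤n⇒m<n∨m≡n M<c
  ... | inj₂ refl = Fin.zero , s≤s z≤n , refl
  ... | inj₁ 1+M<c = let p , p<q , e = h c 1+M<c c< in Fin.suc p , s≤s p<q , e

growthAfter⇒grows : ∀ w → GrowthAfter M w → Grows M w
growthAfter⇒grows [] h = []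
growthAfter⇒grows {M} (y ∷ w) h with y ≤? M
... | yes y≤M = old (proj₁ (h Fin.zero) , y≤M) (growthAfter⇒grows w λ q → proj₁ (h (Fin.suc q)) , earlier q)
  where
  earlier : ∀ q c → M < c → c < lookup w q → ∃ λ p → p Fin.< q × lookup w p ≡ c
  earlier q c M<c c< with proj₂ (h (Fin.suc q)) c M<c c<
  ... | Fin.zero , _ , refl = contradiction y≤M (<⇒≱ M<c)
  ... | Fin.suc p , s≤s p<q , e = p , p<q , e
... | no y≰M with m≤n⇒m<n∨m≡n (≰⇒> y≰M)
...   | inj₁ 1+M<y with _ , () , _ ← proj₂ (h Fin.zero) (suc M) ≤-refl 1+M<y
...   | inj₂ refl = new (growthAfter⇒grows w λ q → proj₁ (h (Fin.suc q)) , earlier q)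
  where
  earlier : ∀ q c → suc M < c → c < lookup w q → ∃ λ p → p Fin.< q × lookup w p ≡ c
  earlier q c 1+M<c c< with proj₂ (h (Fin.suc q)) c (<-trans ≤-refl 1+M<c) c<
  ... | Fin.zero , _ , refl = contradiction 1+M<c (<-irrefl refl)
  ... | Fin.suc p , s≤s p<q , e = p , p<q , e

growth⇔grows : ∀ w → Growth (lookup w) ⇔ Grows 0 w
growth⇔grows w = mk⇔ to from
  where
  to : Growth (lookup w) → Grows 0 w
  to g = growthAfter⇒grows w λ q → proj₁ (g q) , λ where
    (suc c) _ c< → let p , p<q , e = proj₂ (g q) (Fin.fromℕ< (<⇒≤pred c<))
                   in p , p<q , trans e (cong suc (toℕ-fromℕ< (<⇒≤pred c<)))
  <pred⇒ : ∀ {m} n → m < pred n → suc m < n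
  <pred⇒ (suc n) = s≤s
  from : Grows 0 w → Growth (lookup w)
  from g q with pos , h ← grows⇒growthAfter g q =
    pos , λ c → h (suc (Fin.toℕ c)) (s≤s z≤n) (<pred⇒ (lookup w q) (toℕ<n c))

-- Non-crossing forms are exactly the readable words.

head-∈ : (y ∷ u) ⊆ w → y ∈ w
head-∈ s = ⊆-lookup s (here refl)

-- The larger letter `b` cannot be introduced before `a` has been, so an `a` precedes any chosen
-- `b`. In a canonical form a subsequence b a b with a < b thus already yields a b a b.
insertSmaller : ∀ {a b} → Grows M w → M < a → a < b → (b ∷ v) ⊆ w → (a ∷ b ∷ v) ⊆ w
insertSmaller (old (_ , y≤M) g) M<a a<b (refl ∷ s) = contradiction (<-≤-trans a<b y≤M) (<⇒≯ M<a)
insertSmaller (old _ g) M<a a<b (_ ∷ʳ s) = _ ∷ʳ insertSmaller g M<a a<b s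
insertSmaller (new g) M<a a<b (refl ∷ s) = contradiction a<b (≤⇒≯ M<a)
insertSmaller (new g) M<a a<b (_ ∷ʳ s) with m≤n⇒m<n∨m≡n M<a
... | inj₁ 1+M<a = _ ∷ʳ insertSmaller g 1+M<a a<b s
... | inj₂ refl  = refl ∷ s

-- Only letters above the current maximum are ever pushed, so a letter up to `M` that is off the
-- stack cannot return.
popped∉ : IsStack M S → Walk M S w M₁ S₁ → y ≤ M → y ∉ S → y ∉ w
popped∉ st (new p) y≤M y∉S (here refl) = contradiction y≤M 1+n≰n
popped∉ st (new p) y≤M y∉S (there m) =
  popped∉ (pushStack st) p (m≤n⇒m≤1+n y≤M) (λ { (here refl) → contradiction y≤M 1+n≰n ; (there m) → y∉S m }) m
popped∉ st (old s p) y≤M y∉S (here refl) = y∉S (↘⇒∈ s)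
popped∉ st (old s p) y≤M y∉S (there m) = popped∉ (popStack st s) p y≤M (y∉S ∘ ↘-∈ s) m
  where
  ↘-∈ : S ↘ S₁ → y ∈ S₁ → y ∈ S
  ↘-∈ keep    m = m
  ↘-∈ (pop s) m = there (↘-∈ s m)

above∉ : ∀ {a b} → IsStack M (a ∷ S) → Walk M (a ∷ S) w M₁ S₁ → a < b → b ≤ M → b ∉ w
above∉ st@(_ , a> ∷ _) p a<b b≤M = popped∉ st p b≤M
  λ { (here refl) → <-irrefl refl a<b ; (there m) → <⇒≯ a<b (All.lookup a> m) }

-- Taking a pops b, which is then lost for good.
avoids-ab : ∀ {a b} → IsStack M S → Walk M S w M₁ S₁ → b ≤ M → a < b → ¬ (a ∷ b ∷ []) ⊆ w
avoids-ab st (new p)   b≤M a<b (refl ∷ s)  = contradiction (<-≤-trans a<b b≤M) (<⇒≱ (m≤n⇒m≤1+n ≤-refl))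
avoids-ab st (new p)   b≤M a<b (_ ∷ʳ s)    = avoids-ab (pushStack st) p (m≤n⇒m≤1+n b≤M) a<b s
avoids-ab st (old t p) b≤M a<b (refl ∷ s)  = above∉ (popStack st t) p a<b b≤M (head-∈ s)
avoids-ab st (old t p) b≤M a<b (_ ∷ʳ s)    = avoids-ab (popStack st t) p b≤M a<b s

-- Once the first `b` has been read, the maximum is at least `b`, and `avoids-ab` applies to the
-- rest.
avoids-bab : ∀ {a b} → IsStack M S → Walk M S w M₁ S₁ → a < b → ¬ (b ∷ a ∷ b ∷ []) ⊆ w
avoids-bab st (new p)   a<b (refl ∷ s) = avoids-ab (pushStack st) p ≤-refl a<b s
avoids-bab st (new p)   a<b (_ ∷ʳ s)   = avoids-bab (pushStack st) p a<b s
avoids-bab st (old t p) a<b (refl ∷ s) =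
  avoids-ab (popStack st t) p (proj₂ (All.lookup (proj₁ st) (↘⇒∈ t))) a<b s
avoids-bab st (old t p) a<b (_ ∷ʳ s)   = avoids-bab (popStack st t) p a<b s

survives : AllPairs _>_ S → S ↘ c ∷ S₁ → ¬ (c < y) → y ∈ S → y ∈ c ∷ S₁
survives _        keep    _   m           = m
survives (y> ∷ _) (pop s) c≮y (here refl) = contradiction (All.lookup y> (↘⇒∈ s)) c≮y
survives (_ ∷ ps) (pop s) c≮y (there m)   = survives ps s c≮y m

-- The hypotheses are what the part already read imposes on the rest: a letter up to `M` has
-- occurred, so a smaller letter followed by it would complete b a b, and every such letter still to
-- come must be on the stack.
toWalk : IsStack M S → Grows M w →
  (∀ {a b} → a < b → ¬ (b ∷ a ∷ b ∷ []) ⊆ w) →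
  (∀ {a b} → b ≤ M → a < b → ¬ (a ∷ b ∷ []) ⊆ w) →
  (∀ {y} → 1 ≤ y → y ≤ M → y ∈ w → y ∈ S) →
  ∃₂ (Walk M S w)
toWalk st [] _ _ _ = _ , _ , []
toWalk {M} {S} st (new g) bab ab live = _ , _ , new (proj₂ (proj₂ (toWalk (pushStack st) g
    (λ a<b s → bab a<b (_ ∷ʳ s)) ab′ live′)))
  where
  ab′ : ∀ {a b} → b ≤ suc M → a < b → ¬ (a ∷ b ∷ []) ⊆ _
  ab′ b≤ a<b s with m≤n⇒m<n∨m≡n b≤
  ... | inj₁ (s≤s b≤M) = ab b≤M a<b (_ ∷ʳ s)
  -- Here `b` is the letter `suc M` just read, so the pair would complete b a b.
  ... | inj₂ refl      = bab a<b (refl ∷ s)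
  live′ : ∀ {y} → 1 ≤ y → y ≤ suc M → y ∈ _ → y ∈ suc M ∷ S
  live′ 1≤y y≤ m with m≤n⇒m<n∨m≡n y≤
  ... | inj₁ (s≤s y≤M) = there (live 1≤y y≤M (there m))
  ... | inj₂ refl      = here refl
toWalk {M} {S} {c ∷ w} st (old (1≤c , c≤M) g) bab ab live
  with S₁ , s ← ∈⇒↘ (live 1≤c c≤M (here refl)) =
  _ , _ , old s (proj₂ (proj₂ (toWalk (popStack st s) g
    (λ a<b t → bab a<b (_ ∷ʳ t)) (λ b≤M a<b t → ab b≤M a<b (_ ∷ʳ t))
    -- A letter `y` above `c` that recurs would form the excluded pair c y, so every letter still to
    -- come lies at or below `c` and outlives the pop.
    λ 1≤y y≤M m → survives (proj₂ st) s (λ c<y → ab y≤M c<y (refl ∷ from∈ m)) (live 1≤y y≤M (there m)))))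

isNC⇔walk : ∀ n π → IsNC n π ⇔ (length π ≡ n × ∃₂ (Walk 0 [] π))
isNC⇔walk n π = mk⇔ to from
  where
  to : IsNC n π → length π ≡ n × ∃₂ (Walk 0 [] π)
  to (cf , nc) with refl ← length-canonicalForm cf = refl , toWalk ([] , []) g
    (λ {a} {b} a<b s → nc (a , b , a<b , insertSmaller g (All.lookup (grows⇒positive g) (head-∈ (∷ˡ⁻ s))) a<b s))
    -- At the start the maximum is 0, and both conditions on earlier letters hold vacuously.
    (λ { z≤n () }) (λ { () z≤n })
    where g = Equivalence.to (growth⇔grows π) (Equivalence.to (canonicalForm⇔growth π) cf)
  from : length π ≡ n × ∃₂ (Walk 0 [] π) → IsNC n π
  from (refl , _ , _ , p) =
    Equivalence.from (canonicalForm⇔growth π) (Equivalence.from (growth⇔grows π) (walk⇒grows ([] , []) p)) ,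
    λ (a , b , a<b , s) → avoids-bab ([] , []) p a<b (∷ˡ⁻ s)

NC↭reads : ∀ n → NC n ↭ reads n 0 []
NC↭reads n = ∼bag⇒↭ (unique∧set⇒bag (NC-unique n) (reads-unique n ([] , []))
  (mk⇔ (λ m → let e , _ , _ , p = Equivalence.to (isNC⇔walk n _) (Equivalence.to ∈-NC m)
              in subst (λ n → _ ∈ reads n 0 []) e (∈-reads⁺ p))
       (λ m → Equivalence.from ∈-NC (Equivalence.from (isNC⇔walk n _) (∈-reads⁻ n m)))))

-- Evaluation of ballot numbers by binomial coefficients.

C-absorb : ∀ n k → suc k * (suc n C suc k) ≡ suc n * (n C k)
C-absorb n zero = begin
  1 * (suc n C 1) ≡⟨ *-identityˡ _ ⟩
  suc n C 1       ≡⟨ nC1≡n (suc n) ⟩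
  suc n           ≡⟨ *-identityʳ (suc n) ⟨
  suc n * 1       ∎
  where open ≡-Reasoning
C-absorb zero (suc k) = *-zeroʳ (suc (suc k))
C-absorb (suc n) (suc k) = begin
  suc (suc k) * (suc (suc n) C suc (suc k))
    ≡⟨ cong (suc (suc k) *_) (nCk+nC[k+1]≡[n+1]C[k+1] (suc n) (suc k)) ⟨
  suc (suc k) * (t + suc n C suc (suc k))
    ≡⟨ *-distribˡ-+ (suc (suc k)) t _ ⟩
  (t + suc k * t) + suc (suc k) * (suc n C suc (suc k))
    ≡⟨ cong₂ (λ p q → (t + p) + q) (C-absorb n k) (C-absorb n (suc k)) ⟩
  (t + suc n * (n C k)) + suc n * (n C suc k)
    ≡⟨ +-assoc t _ _ ⟩
  t + (suc n * (n C k) + suc n * (n C suc k))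
    ≡⟨ cong (t +_) (*-distribˡ-+ (suc n) (n C k) _) ⟨
  t + suc n * (n C k + n C suc k)
    ≡⟨ cong (λ p → t + suc n * p) (nCk+nC[k+1]≡[n+1]C[k+1] n k) ⟩
  suc (suc n) * (suc n C suc k) ∎
  where
  open ≡-Reasoning
  t = suc n C suc k

C-sym : ∀ j k → (j + k) C j ≡ (j + k) C k
C-sym j k = trans (nCk≡nC[n∸k] (m≤m+n j k)) (cong ((j + k) C_) (m+n∸m≡n j k))

-- The reflection principle; the case n = 0, where C(d , -1) is meant to vanish, is left out.
ballot-reflection : ∀ n d → ballot (suc n) d + (2 * suc n + d) C n ≡ (2 * suc n + d) C suc n
ballot-reflection zero zero = refl
ballot-reflection zero (suc d) = begin
  1 + ballot 1 d + 1             ≡⟨ +-assoc 1 (ballot 1 d) 1 ⟩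
  1 + (ballot 1 d + 1)           ≡⟨ cong suc (ballot-reflection zero d) ⟩
  (2 + d) C 0 + (2 + d) C 1      ≡⟨ nCk+nC[k+1]≡[n+1]C[k+1] (2 + d) 0 ⟩
  (3 + d) C 1                    ∎
  where open ≡-Reasoning
ballot-reflection (suc n) zero = begin
  ballot (suc n) 1 + (2 * suc (suc n) + 0) C suc n
    ≡⟨ cong (λ z → ballot (suc n) 1 + z C suc n) top ⟩
  ballot (suc n) 1 + suc t C suc n
    ≡⟨ cong (ballot (suc n) 1 +_) (nCk+nC[k+1]≡[n+1]C[k+1] t n) ⟨
  ballot (suc n) 1 + (t C n + t C suc n)
    ≡⟨ +-assoc (ballot (suc n) 1) _ _ ⟨
  ballot (suc n) 1 + t C n + t C suc n
    ≡⟨ cong (_+ t C suc n) (ballot-reflection n 1) ⟩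
  t C suc n + t C suc n
    ≡⟨ cong (t C suc n +_) middle ⟩
  t C suc n + t C suc (suc n)
    ≡⟨ nCk+nC[k+1]≡[n+1]C[k+1] t (suc n) ⟩
  suc t C suc (suc n)
    ≡⟨ cong (_C suc (suc n)) top ⟨
  (2 * suc (suc n) + 0) C suc (suc n) ∎
  where
  open ≡-Reasoning
  t = 2 * suc n + 1
  top : 2 * suc (suc n) + 0 ≡ suc t
  top = solve₁ n
    where
    solve₁ : ∀ n → 2 * suc (suc n) + 0 ≡ suc (2 * suc n + 1)
    solve₁ = solve-∀
  -- The row `t = 2n + 3` is odd and has two equal middle entries; this settles depth 0, where the
  -- recurrence has a single summand.
  middle : t C suc n ≡ t C suc (suc n)
  middle = subst (λ z → z C suc n ≡ z C suc (suc n)) (solve₂ n) (C-sym (suc n) (suc (suc n)))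
    where
    solve₂ : ∀ n → suc n + suc (suc n) ≡ 2 * suc n + 1
    solve₂ = solve-∀
ballot-reflection (suc n) (suc d) = begin
  (p + q) + (2 * suc (suc n) + suc d) C suc n
    ≡⟨ cong (λ z → (p + q) + z C suc n) (+-suc (2 * suc (suc n)) d) ⟩
  (p + q) + suc t C suc n
    ≡⟨ cong ((p + q) +_) (nCk+nC[k+1]≡[n+1]C[k+1] t n) ⟨
  (p + q) + (t C n + t C suc n)
    ≡⟨ interchange p q (t C n) (t C suc n) ⟩
  (p + t C n) + (q + t C suc n)
    ≡⟨ cong₂ _+_ ih₁ (ballot-reflection (suc n) d) ⟩
  t C suc n + t C suc (suc n)
    ≡⟨ nCk+nC[k+1]≡[n+1]C[k+1] t (suc n) ⟩
  suc t C suc (suc n)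
    ≡⟨ cong (_C suc (suc n)) (+-suc (2 * suc (suc n)) d) ⟨
  (2 * suc (suc n) + suc d) C suc (suc n) ∎
  where
  open ≡-Reasoning
  t = 2 * suc (suc n) + d
  p = ballot (suc n) (2 + d)
  q = ballot (suc (suc n)) d
  -- Both induction hypotheses concern the same row of Pascal's triangle: lowering `n` by one is
  -- offset by raising `d` by two.
  top : ∀ n d → 2 * suc n + (2 + d) ≡ 2 * suc (suc n) + d
  top = solve-∀
  ih₁ : p + t C n ≡ t C suc n
  ih₁ = subst (λ z → p + z C n ≡ z C suc n) (top n d) (ballot-reflection n (2 + d))

-- For positive r, reflection gives `ballot r 0` = C(2r, r) - C(2r, r - 1), while absorption and
-- symmetry give r C(2r, r) = (r + 1) C(2r, r - 1). The difference leaves C(2r, r - 1), the mirror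
-- image of C(2r, r + 1).
n*ballot≡C : ∀ n → n * ballot n 0 ≡ (2 * n) C (n + 1)
n*ballot≡C zero = refl
n*ballot≡C (suc s) = trans (+-cancelʳ-≡ (r * t) (r * ballot r 0) t (begin
  r * ballot r 0 + r * t     ≡⟨ *-distribˡ-+ r (ballot r 0) t ⟨
  r * (ballot r 0 + t)       ≡⟨ cong (r *_) reflection ⟩
  r * ((2 * r) C r)          ≡⟨ absorbed ⟩
  suc r * t                  ∎)) (trans mirror (cong ((2 * r) C_) (+-comm 1 r)))
  where
  open ≡-Reasoning
  r = suc s
  t = (2 * r) C s
  reflection : ballot r 0 + t ≡ (2 * r) C r
  reflection = subst (λ z → ballot r 0 + z C s ≡ z C r) (+-identityʳ (2 * r)) (ballot-reflection s 0)
  even : ∀ s → s + suc (suc s) ≡ 2 * suc s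
  even = solve-∀
  odd : ∀ s → suc (s + suc s) ≡ 2 * suc s
  odd = solve-∀
  mirror : t ≡ (2 * r) C suc r
  mirror = subst (λ z → z C s ≡ z C suc r) (even s) (C-sym s (suc r))
  absorbed : r * ((2 * r) C r) ≡ suc r * t
  absorbed = begin
    r * ((2 * r) C r)                   ≡⟨ cong (λ z → r * (z C r)) (odd s) ⟨
    r * (suc (s + r) C r)               ≡⟨ C-absorb (s + r) s ⟩
    suc (s + r) * ((s + r) C s)         ≡⟨ cong (suc (s + r) *_) (C-sym s r) ⟩
    suc (s + r) * ((s + r) C r)         ≡⟨ C-absorb (s + r) r ⟨
    suc r * (suc (s + r) C suc r)       ≡⟨ cong (λ z → suc r * (z C suc r)) (odd s) ⟩
    suc r * ((2 * r) C suc r)           ≡⟨ cong (suc r *_) mirror ⟨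
    suc r * t                           ∎

-- Order isomorphism through pairs of corresponding letters.

-- Speaking of pairs of letters instead of positions lets an order isomorphism be cut along
-- concatenations without index arithmetic.
SameOrder : (ℕ → ℕ → Set) → Set
SameOrder R = ∀ {y c y′ c′} → R y c → R y′ c′ → (y < y′ ⇔ c < c′) × (y ≡ y′ ⇔ c ≡ c′)

Zip : List ℕ → List ℕ → ℕ → ℕ → Set
Zip u v y c = (y , c) ∈ zip u v

zip-lookup : (e : length u ≡ length v) → Zip u v y c → ∃[ i ] lookup u i ≡ y × lookup v (Fin.cast e i) ≡ c
zip-lookup {_ ∷ _} {_ ∷ _} e (here refl) = Fin.zero , refl , refl
zip-lookup {_ ∷ _} {_ ∷ _} e (there m) with i , p , q ← zip-lookup (suc-injective e) m = Fin.suc i , p , q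

zip-total : length u ≡ length v → y ∈ u → ∃[ c ] Zip u v y c
zip-total {_ ∷ _} {c ∷ _} e (here refl) = c , here refl
zip-total {_ ∷ _} {_ ∷ _} e (there m) with c , m′ ← zip-total (suc-injective e) m = c , there m′

zip-swap : ∀ u v → Zip u v y c → Zip v u c y
zip-swap (_ ∷ u) (_ ∷ v) (here refl) = here refl
zip-swap (_ ∷ u) (_ ∷ v) (there m)   = there (zip-swap u v m)

zip-∈ˡ : ∀ u v → Zip u v y c → y ∈ u
zip-∈ˡ (_ ∷ u) (_ ∷ v) (here refl) = here refl
zip-∈ˡ (_ ∷ u) (_ ∷ v) (there m)   = there (zip-∈ˡ u v m)

zip-++ˡ : ∀ u v → Zip u v y c → Zip (u ++ u₂) (v ++ v₂) y c
zip-++ˡ (_ ∷ u) (_ ∷ v) (here e)  = here e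
zip-++ˡ (_ ∷ u) (_ ∷ v) (there m) = there (zip-++ˡ u v m)

zip-++ʳ : ∀ u v → length u ≡ length v → Zip u₂ v₂ y c → Zip (u ++ u₂) (v ++ v₂) y c
zip-++ʳ []      []      e m = m
zip-++ʳ (_ ∷ u) (_ ∷ v) e m = there (zip-++ʳ u v (suc-injective e) m)

Zip-map : ∀ (f g : ℕ → ℕ) u v → Zip u v y c → Zip (map f u) (map g v) (f y) (g c)
Zip-map f g (_ ∷ u) (_ ∷ v) (here refl) = here refl
Zip-map f g (_ ∷ u) (_ ∷ v) (there m)   = there (Zip-map f g u v m)

zip-≡ : length u ≡ length v → (∀ {y c} → Zip u v y c → y ≡ c) → u ≡ v
zip-≡ {[]}    {[]}    e h = refl
zip-≡ {_ ∷ _} {_ ∷ _} e h = cong₂ _∷_ (h (here refl)) (zip-≡ (suc-injective e) (h ∘ there))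

orderIsomorphic⇒sameOrder : OrderIsomorphic u v → SameOrder (Zip u v)
orderIsomorphic⇒sameOrder (e , f) m m′
  with i , refl , refl ← zip-lookup e m | j , refl , refl ← zip-lookup e m′ = f i j

sameOrder⇒orderIsomorphic : ∀ {R} → SameOrder R → Pointwise R u v → OrderIsomorphic u v
sameOrder⇒orderIsomorphic so ps =
  Pointwise-length ps , λ p q → so (Pointwise.lookup⁺ ps p) (Pointwise.lookup⁺ ps q)

-- A word whose set of letters is {1, …, k} has the least letters in its order isomorphism class.
downClosed⇒≤ : ∀ (R : ℕ → ℕ → Set) →
  (∀ {y c} → R (suc (suc y)) c → ∃[ c′ ] R (suc y) c′) →
  (∀ {y c y′ c′} → R y c → R y′ c′ → y < y′ → c < c′) →
  (∀ {y c} → R y c → 1 ≤ c) → R y c → y ≤ c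
downClosed⇒≤ {zero}        R down mono pos q = z≤n
downClosed⇒≤ {suc zero}    R down mono pos q = pos q
downClosed⇒≤ {suc (suc y)} R down mono pos q =
  let c′ , q′ = down q in ≤-<-trans (downClosed⇒≤ R down mono pos q′) (mono q′ q ≤-refl)

-- Both words use an initial segment of the positive integers, so each is letterwise minimal in the
-- common order class.
sameOrder⇒≡ : Grows 0 u → Grows 0 v → length u ≡ length v → SameOrder (Zip u v) → u ≡ v
sameOrder⇒≡ {u} {v} gu gv e so = zip-≡ e λ m → ≤-antisym
  (downClosed⇒≤ (Zip u v)
    (λ m → zip-total e (grows⇒downClosed gu (zip-∈ˡ u v m) (s≤s z≤n) (n≤1+n _)))
    (λ m m′ → Equivalence.to (proj₁ (so m m′)))
    (λ m → All.lookup (grows⇒positive gv) (zip-∈ˡ v u (zip-swap u v m))) m)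
  (downClosed⇒≤ (flip (Zip u v))
    (λ m → let y , m′ = zip-total (sym e) (grows⇒downClosed gv (zip-∈ˡ v u (zip-swap u v m)) (s≤s z≤n) (n≤1+n _))
           in y , zip-swap v u m′)
    (λ m m′ → Equivalence.from (proj₁ (so m m′)))
    (λ m → All.lookup (grows⇒positive gu) (zip-∈ˡ u v m)) m)

length-++⁻ : ∀ (u v₁ : List ℕ) → length u ≡ length (v₁ ++ v₂) →
  ∃₂ λ u₁ u₂ → u ≡ u₁ ++ u₂ × length u₁ ≡ length v₁ × length u₂ ≡ length v₂
length-++⁻ u       []       e = [] , u , refl , refl , e
length-++⁻ (y ∷ u) (_ ∷ v₁) e with u₁ , u₂ , refl , e₁ , e₂ ← length-++⁻ u v₁ (suc-injective e) =
  y ∷ u₁ , u₂ , refl , cong suc e₁ , e₂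

≡replicate : ∀ k → length u ≡ length (replicate k c) → (∀ {y} → Zip u (replicate k c) y c → y ≡ x) →
  u ≡ replicate k x
≡replicate {[]}    zero    e h = refl
≡replicate {_ ∷ _} (suc k) e h = cong₂ _∷_ (h (here refl)) (≡replicate k (suc-injective e) λ m → h (there m))

-- Recursive counting of subword occurrences.

length-filter-map : ∀ {A B : Set} {P : B → Set} (P? : Decidable P) (f : A → B) xs →
  length (filter P? (map f xs)) ≡ length (filter (P? ∘ f) xs)
length-filter-map P? f []       = refl
length-filter-map P? f (x ∷ xs) with does (P? (f x))
... | true  = cong suc (length-filter-map P? f xs)
... | false = length-filter-map P? f xs

μ≡0 : ∀ τ w → length w < length τ → μ τ w ≡ 0
μ≡0 τ w lt = cong (λ k → length (filter (occursAt? τ w) (upTo k))) (m≤n⇒m∸n≡0 lt)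

-- Occurrences are split by whether they start at `y`. The filter of a singleton is an indicator, so
-- that summing over many words turns it into the length of one filtered list.
μ-∷ : ∀ c τ y w → let τ = c ∷ τ in
  μ τ (y ∷ w) ≡ length (filter (λ w → occursAt? τ (y ∷ w) 0) (w ∷ [])) + μ τ w
μ-∷ c τ y w with length τ ≤? length w
... | yes l≤ = begin
  length (filter (occursAt? τ′ (y ∷ w)) (upTo (suc (length w) ∸ length τ)))
    ≡⟨ cong (λ k → length (filter (occursAt? τ′ (y ∷ w)) (upTo k))) (+-∸-assoc 1 l≤) ⟩
  length (filter (occursAt? τ′ (y ∷ w)) (upTo (suc k)))
    ≡⟨ cong (λ is → length (filter (occursAt? τ′ (y ∷ w)) (0 ∷ is))) (map-upTo suc k) ⟨
  length (filter (occursAt? τ′ (y ∷ w)) (0 ∷ map suc (upTo k)))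
    ≡⟨ split ⟩
  length (filter (λ w → occursAt? τ′ (y ∷ w) 0) (w ∷ [])) + μ τ′ w ∎
  where
  open ≡-Reasoning
  τ′ = c ∷ τ
  k = length w ∸ length τ
  split : length (filter (occursAt? τ′ (y ∷ w)) (0 ∷ map suc (upTo k))) ≡
          length (filter (λ w → occursAt? τ′ (y ∷ w) 0) (w ∷ [])) + μ τ′ w
  split with does (occursAt? τ′ (y ∷ w) 0)
  ... | true  = cong suc (length-filter-map (occursAt? τ′ (y ∷ w)) suc (upTo k))
  ... | false = length-filter-map (occursAt? τ′ (y ∷ w)) suc (upTo k)
-- The word is too short for the pattern: the truncated subtraction leaves no positions, and all
-- terms vanish.
... | no l≰ = trans (μ≡0 (c ∷ τ) (y ∷ w) (s≤s (≰⇒> l≰)))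
  (sym (cong₂ _+_
    (cong length (filter-reject (λ w → occursAt? (c ∷ τ) (y ∷ w) 0) {xs = []} tooShort))
    (μ≡0 (c ∷ τ) w (m<n⇒m<1+n (≰⇒> l≰)))))
  where
  tooShort : ¬ OccursAt (c ∷ τ) (y ∷ w) 0
  tooShort (e , _) = l≰ (subst (_≤ length w)
    (trans (sym (length-take (length τ) w)) (suc-injective e)) (m⊓n≤n (length τ) (length w)))

length-filter-∷ : ∀ {A : Set} {P : A → Set} (P? : Decidable P) x xs →
  length (filter P? (x ∷ xs)) ≡ length (filter P? (x ∷ [])) + length (filter P? xs)
length-filter-∷ P? x xs with does (P? x)
... | true  = refl
... | false = refl

sum-map-filter : ∀ {A : Set} {P : A → Set} (P? : Decidable P) (F G : A → ℕ) →
  (∀ x → F x ≡ length (filter P? (x ∷ [])) + G x) →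
  ∀ xs → sum (map F xs) ≡ length (filter P? xs) + sum (map G xs)
sum-map-filter P? F G h []       = refl
sum-map-filter P? F G h (x ∷ xs) = begin
  F x + sum (map F xs)
    ≡⟨ cong₂ _+_ (h x) (sum-map-filter P? F G h xs) ⟩
  (length (filter P? (x ∷ [])) + G x) + (length (filter P? xs) + sum (map G xs))
    ≡⟨ interchange (length (filter P? (x ∷ []))) _ _ _ ⟩
  (length (filter P? (x ∷ [])) + length (filter P? xs)) + (G x + sum (map G xs))
    ≡⟨ cong (_+ (G x + sum (map G xs))) (length-filter-∷ P? x xs) ⟨
  length (filter P? (x ∷ xs)) + (G x + sum (map G xs)) ∎
  where open ≡-Reasoning

-- Occurrences of the pattern that start at a given letter.

module _ (a b : ℕ) {k : ℕ} {Sρ ρ : List ℕ} (walkρ : Walk 0 [] ρ k Sρ) where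

  -- Here `a` and `b` are one less than the exponents of the pattern, so both runs of ones are
  -- nonempty.
  τ : List ℕ
  τ = replicate (suc a) 1 ++ map suc ρ ++ replicate (suc b) 1

  -- What follows the letter x in an occurrence of τ that starts with x, when the maximum so far is M.
  completion : ℕ → ℕ → List ℕ
  completion M x = replicate a x ++ map (M +_) ρ ++ replicate (suc b) x

  -- Repeating `x` keeps it on top, the copy of `ρ` is read above it, and the first trailing `x`
  -- pops whatever that copy left.
  walk-completion : Walk M (x ∷ S) (completion M x) (M + k) (x ∷ S)
  walk-completion {M} {x} {S} = walk-++⁺ (walk-replicate a) (walk-++⁺
    (subst (λ z → Walk z (x ∷ S) (map (M +_) ρ) (M + k) (map (M +_) Sρ ++ x ∷ S)) (+-identityʳ M) (translate M walkρ))
    (old (++-↘ (map (M +_) Sρ)) (walk-replicate b)))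

  data Match (M x : ℕ) : ℕ → ℕ → Set where
    outer : Match M x x 1
    inner : 1 ≤ c → Match M x (M + c) (suc c)

  -- Since x ≤ M < M + c for positive c, the inner letters lie above `x` just as those of `ρ + 1`
  -- lie above 1.
  match-sameOrder : x ≤ M → SameOrder (Match M x)
  match-sameOrder x≤M outer outer =
    mk⇔ (λ p → contradiction p (<-irrefl refl)) (λ { (s≤s ()) }) , mk⇔ (λ _ → refl) (λ _ → refl)
  match-sameOrder {x} {M} x≤M outer (inner 1≤c) =
    mk⇔ (λ _ → s≤s 1≤c) (λ _ → x<) ,
    mk⇔ (λ e → contradiction x< (<-irrefl e)) (λ e → contradiction (s≤s 1≤c) (<-irrefl e))
    where x< = ≤-<-trans x≤M (m<m+n M 1≤c)
  match-sameOrder {x} {M} x≤M (inner 1≤c) outer =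
    mk⇔ (λ p → contradiction p (<⇒≯ x<)) (λ { (s≤s ()) }) ,
    mk⇔ (λ e → contradiction x< (<-irrefl (sym e))) (λ e → contradiction (s≤s 1≤c) (<-irrefl (sym e)))
    where x< = ≤-<-trans x≤M (m<m+n M 1≤c)
  match-sameOrder {x} {M} x≤M (inner _) (inner _) =
    mk⇔ (s≤s ∘ +-cancelˡ-< M _ _) (λ { (s≤s p) → +-monoʳ-< M p }) ,
    mk⇔ (cong suc ∘ +-cancelˡ-≡ M _ _) (cong (M +_) ∘ suc-injective)

  completion-match : ∀ M x → Pointwise (Match M x) (x ∷ completion M x) τ
  completion-match M x = Pointwise.++⁺ (Pointwise.replicate⁺ outer (suc a))
    (Pointwise.++⁺ (inners (grows⇒positive (walk⇒grows ([] , []) walkρ))) (Pointwise.replicate⁺ outer (suc b)))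
    where
    inners : All (1 ≤_) u → Pointwise (Match M x) (map (M +_) u) (map suc u)
    inners []       = []
    inners (p ∷ ps) = inner p ∷ inners ps

  length-completion : ∀ M x → suc (length (completion M x)) ≡ length τ
  length-completion M x = Pointwise-length (completion-match M x)

  completion⇒occurs : x ≤ M → OccursAt τ (x ∷ completion M x ++ v) 0
  completion⇒occurs {x} {M} {v} x≤M = subst (λ u → OrderIsomorphic u τ) (sym window)
    (sameOrder⇒orderIsomorphic (match-sameOrder x≤M) (completion-match M x))
    where
    window : take (length τ) (x ∷ completion M x ++ v) ≡ x ∷ completion M x
    window = trans (cong (λ n → take n (x ∷ completion M x ++ v)) (sym (length-completion M x)))
                   (cong (x ∷_) (take-++-length (completion M x)))
      where
      take-++-length : ∀ u → take (length u) (u ++ v) ≡ u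
      take-++-length []      = refl
      take-++-length (y ∷ u) = cong (y ∷_) (take-++-length u)

  -- The window is cut like `τ`. The outer runs match the ones of `τ`, as the first letter does, and
  -- so consist of `x`; the middle run is forced by the stack discipline.
  occurs⇒completion : IsStack M (x ∷ S) → Walk M (x ∷ S) w M₁ S₁ → OccursAt τ (x ∷ w) 0 →
    ∃[ v ] w ≡ completion M x ++ v
  occurs⇒completion {M} {x} {S} {w} st walk occ
    with u₁ , u₂₃ , split₁ , len₁ , len₂₃ ← length-++⁻ (take (length τ) (x ∷ w)) (replicate (suc a) 1) (proj₁ occ)
    with u₂ , u₃ , refl , len₂ , len₃ ← length-++⁻ u₂₃ (map suc ρ) len₂₃
    = rest , w≡
    where
    l = length (replicate a 1 ++ map suc ρ ++ replicate (suc b) 1)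
    rest = drop l w

    so : SameOrder (Zip (u₁ ++ u₂ ++ u₃) τ)
    so = subst (λ u → SameOrder (Zip u τ)) split₁ (orderIsomorphic⇒sameOrder occ)

    first : Zip (u₁ ++ u₂ ++ u₃) τ x 1
    first = subst (λ u → Zip u τ x 1) split₁ (here refl)

    in₁ : Zip u₁ (replicate (suc a) 1) y c → Zip (u₁ ++ u₂ ++ u₃) τ y c
    in₁ = zip-++ˡ u₁ _

    in₂ : Zip u₂ (map suc ρ) y c → Zip (u₁ ++ u₂ ++ u₃) τ y c
    in₂ m = zip-++ʳ u₁ (replicate (suc a) 1) len₁ (zip-++ˡ u₂ _ m)

    in₃ : Zip u₃ (replicate (suc b) 1) y c → Zip (u₁ ++ u₂ ++ u₃) τ y c
    in₃ m = zip-++ʳ u₁ (replicate (suc a) 1) len₁ (zip-++ʳ u₂ (map suc ρ) len₂ m)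

    u₁≡ : u₁ ≡ replicate (suc a) x
    u₁≡ = ≡replicate (suc a) len₁ λ m → Equivalence.from (proj₂ (so (in₁ m) first)) refl

    u₃≡ : u₃ ≡ replicate (suc b) x
    u₃≡ = ≡replicate (suc b) len₃ λ m → Equivalence.from (proj₂ (so (in₃ m) first)) refl

    -- One of the `suc a` leading copies of `x` is the letter in front of `w`, so `a` copies remain.
    w-split : w ≡ replicate a x ++ (u₂ ++ (u₃ ++ rest))
    w-split = begin
      w                                  ≡⟨ take++drop≡id l w ⟨
      take l w ++ rest                      ≡⟨ cong (_++ rest) (∷-injectiveʳ (trans split₁ (cong (_++ u₂ ++ u₃) u₁≡))) ⟩
      (replicate a x ++ (u₂ ++ u₃)) ++ rest ≡⟨ ++-assoc (replicate a x) _ rest ⟩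
      replicate a x ++ ((u₂ ++ u₃) ++ rest) ≡⟨ cong (replicate a x ++_) (++-assoc u₂ u₃ rest) ⟩
      replicate a x ++ (u₂ ++ (u₃ ++ rest)) ∎
      where open ≡-Reasoning

    positiveρ : All (1 ≤_) ρ
    positiveρ = grows⇒positive (walk⇒grows ([] , []) walkρ)

    u₂>x : All (x <_) u₂
    u₂>x = All.tabulate λ m →
      let c , z = zip-total len₂ m
          c′ , c′∈ , c≡ = ∈-map⁻ suc (zip-∈ˡ _ _ (zip-swap u₂ _ z))
      in Equivalence.from (proj₁ (so first (in₂ z))) (subst (1 <_) (sym c≡) (s≤s (All.lookup positiveρ c′∈)))

    ≤x : All (_≤ x) (x ∷ S)
    ≤x = ≤-refl ∷ All.map <⇒≤ (AllPairs.head (proj₂ st))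

    -- All letters of `u₂` exceed `x`, the top of the stack, so they are readable from the empty
    -- stack and are a word shifted by `M`.
    middle : ∃[ u ] u₂ ≡ map (M +_) u × ∃₂ (Walk 0 [] u)
    middle =
      let _ , _ , p , _ = walk-++⁻ u₂ (walk-determined st (walk-replicate a) (subst (λ w → Walk M (x ∷ S) w _ _) w-split walk))
          M₂ , S₂ , q = restrict [] ≤x p u₂>x
      in untranslate M [] (subst (λ z → Walk z [] u₂ M₂ S₂) (sym (+-identityʳ M)) q)

    u₂≡ : u₂ ≡ map (M +_) ρ
    u₂≡ with u , refl , _ , _ , p ← middle = cong (map (M +_)) (sameOrder⇒≡
      (walk⇒grows ([] , []) p) (walk⇒grows ([] , []) walkρ)
      (trans (sym (length-map (M +_) u)) (trans len₂ (length-map suc ρ)))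
      λ m m′ → let lt , eq = so (in₂ (Zip-map (M +_) suc u ρ m)) (in₂ (Zip-map (M +_) suc u ρ m′)) in
        mk⇔ (s≤s⁻¹ ∘ Equivalence.to lt ∘ +-monoʳ-< M) (+-cancelˡ-< M _ _ ∘ Equivalence.from lt ∘ s≤s) ,
        mk⇔ (suc-injective ∘ Equivalence.to eq ∘ cong (M +_)) (+-cancelˡ-≡ M _ _ ∘ Equivalence.from eq ∘ cong suc))

    w≡ : w ≡ completion M x ++ rest
    w≡ = begin
      w                                                               ≡⟨ w-split ⟩
      replicate a x ++ (u₂ ++ (u₃ ++ rest))                              ≡⟨ cong₂ (λ p q → replicate a x ++ (p ++ (q ++ rest))) u₂≡ u₃≡ ⟩
      replicate a x ++ (map (M +_) ρ ++ (replicate (suc b) x ++ rest))   ≡⟨ cong (replicate a x ++_) (++-assoc (map (M +_) ρ) _ rest) ⟨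
      replicate a x ++ ((map (M +_) ρ ++ replicate (suc b) x) ++ rest)   ≡⟨ ++-assoc (replicate a x) _ rest ⟨
      completion M x ++ rest                                             ∎
      where open ≡-Reasoning

  module _ {M x : ℕ} {S : List ℕ} (st : IsStack M (x ∷ S)) (r : ℕ) where

    starts : List (List ℕ)
    starts = filter (λ w → occursAt? τ (x ∷ w) 0) (reads (r + length (completion M x)) M (x ∷ S))

    completions : List (List ℕ)
    completions = map (completion M x ++_) (reads r (M + k) (x ∷ S))

    ∈-starts⇔∈-completions : w ∈ starts ⇔ w ∈ completions
    ∈-starts⇔∈-completions = mk⇔ to from
      where
      to : w ∈ starts → w ∈ completions
      to m with m′ , occ ← ∈-filter⁻ (λ w → occursAt? τ (x ∷ w) 0) {xs = reads (r + length (completion M x)) M (x ∷ S)} m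
           with len , _ , _ , p ← ∈-reads⁻ (r + length (completion M x)) m′
           with v , refl ← occurs⇒completion st p occ =
        ∈-map⁺ (completion M x ++_) (subst (λ n → v ∈ reads n (M + k) (x ∷ S))
          (+-cancelˡ-≡ (length (completion M x)) _ _
            (trans (sym (length-++ (completion M x))) (trans len (+-comm r _))))
          (∈-reads⁺ (walk-determined st walk-completion p)))
      from : w ∈ completions → w ∈ starts
      from m with v , v∈ , refl ← ∈-map⁻ (completion M x ++_) m
             with len , _ , _ , p ← ∈-reads⁻ r v∈ =
        ∈-filter⁺ (λ w → occursAt? τ (x ∷ w) 0)
          (subst (λ n → completion M x ++ v ∈ reads n M (x ∷ S))
            (trans (length-++ (completion M x)) (trans (+-comm _ (length v)) (cong (_+ length (completion M x)) len)))
            (∈-reads⁺ (walk-++⁺ walk-completion p)))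
          (completion⇒occurs (proj₂ (All.head (proj₁ st))))

    -- The completion restores the stack and only raises the maximum, and the number of readable
    -- words is a function of the depth.
    length-starts : length starts ≡ ballot r (suc (length S))
    length-starts = begin
      length starts                        ≡⟨ ↭-length (∼bag⇒↭ (unique∧set⇒bag starts! completions! ∈-starts⇔∈-completions)) ⟩
      length completions                   ≡⟨ length-map _ (reads r (M + k) (x ∷ S)) ⟩
      length (reads r (M + k) (x ∷ S))     ≡⟨ length-reads r st′ ⟩
      ballot r (suc (length S))            ∎
      where
      open ≡-Reasoning
      st′ = walkStack st walk-completion
      starts! : Unique starts
      starts! = Unique.filter⁺ (λ w → occursAt? τ (x ∷ w) 0) (reads-unique (r + length (completion M x)) st)
      completions! : Unique completions
      completions! = Unique.map⁺ (++-cancelˡ (completion M x) _ _) (reads-unique r st′)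

  -- Summation over all readable words.

  -- Induction on `r`: after a first letter, the occurrences starting there contribute one ballot
  -- number and the later ones `r` times the same number. For `r = 0` the words are one letter
  -- shorter than `τ`.
  sum-μ-reads : ∀ r {l} → suc l ≡ length τ → IsStack M S →
    sum (map (μ τ) (reads (r + l) M S)) ≡ r * ballot r (length S)
  sum-μ-reads zero {l} l≡ st = none (reads l _ _) λ m → subst (_< length τ) (sym (proj₁ (∈-reads⁻ l m))) (≤-reflexive l≡)
    where
    none : ∀ ws → (∀ {w} → w ∈ ws → length w < length τ) → sum (map (μ τ) ws) ≡ 0
    none []       h = refl
    none (w ∷ ws) h = cong₂ _+_ (μ≡0 τ w (h (here refl))) (none ws (h ∘ there))
  sum-μ-reads (suc r) {l} l≡ st = sum-reads (μ τ) (suc r) (r + l) r branch st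
    where
    open ≡-Reasoning
    branch : ∀ {M y S} → IsStack M (y ∷ S) →
      sum (map (μ τ) (map (y ∷_) (reads (r + l) M (y ∷ S)))) ≡ suc r * ballot r (suc (length S))
    branch {M} {y} {S} st = begin
      sum (map (μ τ) (map (y ∷_) ws))
        ≡⟨ cong sum (map-∘ ws) ⟨
      sum (map (λ w → μ τ (y ∷ w)) ws)
        ≡⟨ sum-map-filter (λ w → occursAt? τ (y ∷ w) 0) _ (μ τ) (μ-∷ 1 (replicate a 1 ++ map suc ρ ++ replicate (suc b) 1) y) ws ⟩
      length (filter (λ w → occursAt? τ (y ∷ w) 0) ws) + sum (map (μ τ) ws)
        ≡⟨ cong₂ _+_ filtered (sum-μ-reads r l≡ st) ⟩
      ballot r (suc (length S)) + r * ballot r (suc (length S)) ∎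
      where
      ws = reads (r + l) M (y ∷ S)
      filtered : length (filter (λ w → occursAt? τ (y ∷ w) 0) ws) ≡ ballot r (suc (length S))
      filtered = subst (λ l → length (filter (λ w → occursAt? τ (y ∷ w) 0) (reads (r + l) M (y ∷ S))) ≡ _)
        (suc-injective (trans (length-completion M y) (sym l≡))) (length-starts st r)

corollary7 : (a b m n : ℕ) → 1 ≤ a → 1 ≤ b → 1 ≤ m →
    (ρ : List ℕ) → IsNC m ρ → m + a + b ∸ 1 ≤ n →
    let τ = replicate a 1 ++ map suc ρ ++ replicate b 1
        r = suc n ∸ (m + a + b)
    in sum (map (μ τ) (NC n)) ≡ (2 * r) C (r + 1)
corollary7 (suc a) (suc b) m n _ _ _ ρ nc bound
  with refl , _ , _ , walkρ ← Equivalence.to (isNC⇔walk m ρ) nc = begin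
  sum (map (μ (τ a b walkρ)) (NC n))              ≡⟨ sum-↭ (↭.map⁺ (μ (τ a b walkρ)) (NC↭reads n)) ⟩
  sum (map (μ (τ a b walkρ)) (reads n 0 []))      ≡⟨ cong (λ n → sum (map (μ (τ a b walkρ)) (reads n 0 []))) r+l≡n ⟨
  sum (map (μ (τ a b walkρ)) (reads (r + l) 0 [])) ≡⟨ sum-μ-reads a b walkρ r l≡ ([] , []) ⟩
  r * ballot r 0                                  ≡⟨ n*ballot≡C r ⟩
  (2 * r) C (r + 1)                               ∎
  where
  open ≡-Reasoning
  l = m + suc a + suc b ∸ 1
  r = suc n ∸ (m + suc a + suc b)
  1+l≡ : suc l ≡ m + suc a + suc b
  1+l≡ = m+[n∸m]≡n (≤-trans (s≤s z≤n) (m≤n+m (suc b) (m + suc a)))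
  -- The lower bound on `n` makes the truncated subtraction in `r` exact.
  r+l≡n : r + l ≡ n
  r+l≡n = suc-injective (trans (sym (+-suc r l)) (trans (cong (r +_) 1+l≡)
    (m∸n+n≡m (subst (_≤ suc n) 1+l≡ (s≤s bound)))))
  l≡ : suc l ≡ length (τ a b walkρ)
  l≡ = begin
    suc l                                     ≡⟨ 1+l≡ ⟩
    length ρ + suc a + suc b                  ≡⟨ cong (_+ suc b) (+-comm (length ρ) (suc a)) ⟩
    suc a + length ρ + suc b                  ≡⟨ +-assoc (suc a) (length ρ) (suc b) ⟩
    suc a + (length ρ + suc b)                ≡⟨ cong₂ _+_ (length-replicate (suc a)) (cong₂ _+_ (length-map suc ρ) (length-replicate (suc b))) ⟨
    length (replicate (suc a) 1) + (length (map suc ρ) + length (replicate (suc b) 1))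
      ≡⟨ cong (length (replicate (suc a) 1) +_) (length-++ (map suc ρ)) ⟨
    length (replicate (suc a) 1) + length (map suc ρ ++ replicate (suc b) 1)
      ≡⟨ length-++ (replicate (suc a) 1) ⟨
    length (τ a b walkρ) ∎
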